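{- Let $w_1=a$, $w_2=b$, $w_3=ba$, $w_4=baabbaa$, and $w_n = b\cdot\mathit{TM}_{2n-8}\cdot\overline{\mathit{TM}_{2n-6}}\cdot\overline{\mathit{TM}_{2n-6}}'$ for $n\ge 5$. Then: (1) the infinite concatenation $w_1w_2w_3\cdots$ equals the infinite Thue–Morse word $\mathcal{TM}$, i.e. $\mathcal{TM}=\lim_{n\to\infty} w_1\cdots w_n$; (2) $w_n\preceq w_{n+1}$ for every $n\ge1$; (3) $w_n$ is a Nyldon word for every $n\ge 1$. In particular, $\mathcal{TM}$ admits a factorization into an infinite lexicographically non-decreasing sequence of Nyldon words.
   Context: Strings are over the binary alphabet $\{a,b\}$ ordered by $a \prec b$, and $\prec$ also denotes the induced lexicographic order on strings: $x \prec y$ iff $x$ is a proper prefix of $y$, or there is $i$ with $x[1..i-1]=y[1..i-1]$ and $x[i]\prec y[i]$; $x\preceq y$ means $x\prec y$ or $x=y$. Nyldon words are defined recursively: every string of length $1$ is a Nyldon word; a string $w$ with $|w|\ge 2$ is a Nyldon word iff there is no factorization $w=\gamma_1\cdots\gamma_m$ with $m\ge 2$, each $\gamma_i$ a nonempty Nyldon word, and $\gamma_1\preceq\gamma_2\preceq\cdots\preceq\gamma_m$. For a binary string $w$, $\overline{w}$ is obtained by exchanging $a$ and $b$ letterwise, and $w'$ is $w$ with its last letter removed; $\overline{w}'$ means $(\overline{w})'$. Thue–Morse words: $\mathit{TM}_0=a$ and $\mathit{TM}_k=\mathit{TM}_{k-1}\cdot\overline{\mathit{TM}_{k-1}}$ for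 $k\ge1$; the infinite Thue–Morse word is $\mathcal{TM}=\lim_{k\to\infty}\mathit{TM}_k$ (each $\mathit{TM}_k$ is a prefix of $\mathit{TM}_{k+1}$). -}

module Defs where

open import Data.Bool.Base using (Bool; true; false; not)
import Data.Bool.Base as Bool
open import Data.Empty using (⊥; ⊥-elim)
open import Data.Fin.Base using (fromℕ<)
open import Data.List.Base using (List; []; _∷_; [_]; _++_; map; concat; length; take; lookup; applyUpTo)
open import Data.List.Properties using (length-++; length-map)
open import Data.List.Relation.Binary.Lex.Strict using (Lex-<)
open import Data.List.Relation.Unary.All as All using (All; []; _∷_)
open import Data.List.Relation.Unary.Linked using (Linked)
open import Data.Nat.Base using (ℕ; zero; suc; pred; _+_; _*_; _∸_; _≤_; _<_; _≥_; z≤n; s≤s; z<s; s<s; s≤s⁻¹; s<s⁻¹; _≤′_; ≤′-refl; ≤′-step)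
open import Data.Nat.Properties using (≤-refl; ≤-trans; <-≤-trans; ≤-<-trans; m≤m+n; m≤n+m; m<m+n; m<n+m; n≤1+n; +-mono-≤; ≤⇒≤′; ≤′⇒≤)
open import Data.Product.Base using (Σ-syntax; ∃-syntax; _×_; _,_)
open import Data.Sum.Base using (_⊎_; inj₁; inj₂)
open import Function.Base using (_∘_)
open import Function.Bundles using (_⇔_; mk⇔)
open import Relation.Binary.PropositionalEquality using (_≡_; _≢_; refl; sym; trans; cong; cong₂; subst)
open import Relation.Nullary.Negation.Core using (¬_)

-- The alphabet is Bool, whose library order has false < true.

Letter : Set
Letter = Bool

pattern a = false
pattern b = true

Word : Set
Word = List Letter

infix 4 _≺_ _⪯_

_≺_ : Word → Word → Set
_≺_ = Lex-< _≡_ Bool._<_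

_⪯_ : Word → Word → Set
x ⪯ y = x ≺ y ⊎ x ≡ y

complement : Word → Word
complement = map not

dropLast : Word → Word
dropLast x = take (pred (length x)) x

-- A factorization x = γ₁ ⋯ γₘ with m ≥ 2, γ₁ ⪯ ⋯ ⪯ γₘ, and every γᵢ
-- nonempty and satisfying P.

NondecreasingFactorization : (Word → Set) → Word → Set
NondecreasingFactorization P x =
  Σ[ γs ∈ List Word ]
    2 ≤ length γs × All (_≢ []) γs × All P γs × Linked _⪯_ γs × concat γs ≡ x

-- The recursive definition of Nyldon words refers to itself negatively, so
-- it is not an inductive type.  It is well founded on length, and the ℕ
-- argument below only bounds the depth of the recursion: for words of length
-- at most n, NyldonWithin n does not depend on n (NyldonWithin-irrelevant).

NyldonWithin : ℕ → Word → Set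
NyldonWithin zero    x = ⊥
NyldonWithin (suc n) x =
  length x ≡ 1 ⊎
  (2 ≤ length x × ¬ NondecreasingFactorization (NyldonWithin n) x)

Nyldon : Word → Set
Nyldon x = NyldonWithin (length x) x

TM : ℕ → Word
TM zero    = [ a ]
TM (suc k) = TM k ++ complement (TM k)

length>0 : ∀ {x : Word} → x ≢ [] → 0 < length x
length>0 {[]}    x≢[] = ⊥-elim (x≢[] refl)
length>0 {_ ∷ _} _    = z<s

k<length-TM : ∀ k → k < length (TM k)
k<length-TM zero    = z<s
k<length-TM (suc k) = subst (suc k <_) (sym eq) (+-mono-≤ (≤-trans (s≤s z≤n) ih) ih)
  where
  ih = k<length-TM k
  eq : length (TM (suc k)) ≡ length (TM k) + length (TM k)
  eq = trans (length-++ (TM k)) (cong (length (TM k) +_) (length-map not (TM k)))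

-- Infinite words, indexed from 0.

InfWord : Set
InfWord = ℕ → Letter

-- Limit u x states that x is the limit of the finite words u n: every
-- finite prefix of x is a prefix of all but finitely many of them.  Since
-- applyUpTo x k has length k, this forces length (u n) → ∞.

Limit : (ℕ → Word) → InfWord → Set
Limit u x = ∀ k → ∃[ N ] (∀ n → n ≥ N → take k (u n) ≡ applyUpTo x k)

-- TM-limit below shows that this is the limit of the words TM k.

𝒯ℳ : InfWord
𝒯ℳ i = lookup (TM i) (fromℕ< (k<length-TM i))

-- Sequences of words are indexed from 1; the value at 0 is never used.
-- concatTo f n is f 1 ++ ⋯ ++ f n.

concatTo : (ℕ → Word) → ℕ → Word
concatTo f n = concat (applyUpTo (f ∘ suc) n)

w : ℕ → Word
w 0 = []
w 1 = a ∷ []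
w 2 = b ∷ []
w 3 = b ∷ a ∷ []
w 4 = b ∷ a ∷ a ∷ b ∷ b ∷ a ∷ a ∷ []
w n@(suc (suc (suc (suc (suc _))))) =
  [ b ] ++ TM (2 * n ∸ 8)
        ++ complement (TM (2 * n ∸ 6))
        ++ dropLast (complement (TM (2 * n ∸ 6)))

factor-≤ : ∀ (γs : List Word) → All (λ γ → length γ ≤ length (concat γs)) γs
factor-≤ []       = []
factor-≤ (γ ∷ γs) =
  subst (length γ ≤_) (sym eq) (m≤m+n _ _) ∷
  All.map (λ le → ≤-trans le (subst (length (concat γs) ≤_) (sym eq) (m≤n+m _ _)))
          (factor-≤ γs)
  where
  eq : length (γ ++ concat γs) ≡ length γ + length (concat γs)
  eq = length-++ γ

factor-< : ∀ (γs : List Word) → 2 ≤ length γs → All (_≢ []) γs →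
           All (λ γ → length γ < length (concat γs)) γs
factor-< (_ ∷ []) (s≤s ())
factor-< (γ ∷ γs@(δ ∷ _)) _ (γ≢[] ∷ δ≢[] ∷ _) =
  subst (length γ <_) (sym eq) (m<m+n (length γ) rest>0) ∷
  All.map (λ le → ≤-<-trans le
            (subst (length (concat γs) <_) (sym eq) (m<n+m _ (length>0 γ≢[]))))
          (factor-≤ γs)
  where
  eq : length (γ ++ concat γs) ≡ length γ + length (concat γs)
  eq = length-++ γ
  rest>0 : 0 < length (concat γs)
  rest>0 with δ≤ ∷ _ ← factor-≤ γs = <-≤-trans (length>0 δ≢[]) δ≤

NondecreasingFactorization-map :
  ∀ {P Q : Word → Set} {x} → (∀ γ → length γ < length x → P γ → Q γ) →
  NondecreasingFactorization P x → NondecreasingFactorization Q x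
NondecreasingFactorization-map f (γs , 2≤ , ne , ps , mono , refl) =
  γs , 2≤ , ne ,
  All.zipWith (λ { {γ} (lt , p) → f γ lt p }) (factor-< γs 2≤ ne , ps) ,
  mono , refl

NyldonWithin-irrelevant :
  ∀ m n x → length x ≤ m → length x ≤ n → NyldonWithin m x → NyldonWithin n x
NyldonWithin-irrelevant zero    _       x _   _   ()
NyldonWithin-irrelevant (suc m) zero    x _   le (inj₁ eq) with () ← subst (_≤ 0) eq le
NyldonWithin-irrelevant (suc m) zero    x _   le (inj₂ (2≤ , _)) with () ← ≤-trans 2≤ le
NyldonWithin-irrelevant (suc m) (suc n) x _   _  (inj₁ eq) = inj₁ eq
NyldonWithin-irrelevant (suc m) (suc n) x lem len (inj₂ (2≤ , ¬fac)) =
  inj₂ (2≤ , ¬fac ∘ NondecreasingFactorization-map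
    (λ γ lt → NyldonWithin-irrelevant n m γ
      (s≤s⁻¹ (<-≤-trans lt len)) (s≤s⁻¹ (<-≤-trans lt lem))))

-- The defining recursion of Nyldon words.

Nyldon-unfold : ∀ x →
  Nyldon x ⇔ (length x ≡ 1 ⊎ (2 ≤ length x × ¬ NondecreasingFactorization Nyldon x))
Nyldon-unfold x = mk⇔ (to ∘ grow) (shrink ∘ from)
  where
  ℓ = length x
  grow : Nyldon x → NyldonWithin (suc ℓ) x
  grow = NyldonWithin-irrelevant ℓ (suc ℓ) x ≤-refl (n≤1+n _)
  shrink : NyldonWithin (suc ℓ) x → Nyldon x
  shrink = NyldonWithin-irrelevant (suc ℓ) ℓ x (n≤1+n _) ≤-refl
  to : NyldonWithin (suc ℓ) x →
       length x ≡ 1 ⊎ (2 ≤ ℓ × ¬ NondecreasingFactorization Nyldon x)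
  to (inj₁ eq)          = inj₁ eq
  to (inj₂ (2≤ , ¬fac)) = inj₂ (2≤ , ¬fac ∘ NondecreasingFactorization-map
    (λ γ lt → NyldonWithin-irrelevant _ _ γ ≤-refl (≤-trans (n≤1+n _) lt)))
  from : length x ≡ 1 ⊎ (2 ≤ ℓ × ¬ NondecreasingFactorization Nyldon x) →
         NyldonWithin (suc ℓ) x
  from (inj₁ eq)          = inj₁ eq
  from (inj₂ (2≤ , ¬fac)) = inj₂ (2≤ , ¬fac ∘ NondecreasingFactorization-map
    (λ γ lt → NyldonWithin-irrelevant _ _ γ (≤-trans (n≤1+n _) lt) ≤-refl))

lookup-extend : ∀ (xs ys : Word) {i} (p : i < length xs) (q : i < length (xs ++ ys)) →
                lookup (xs ++ ys) (fromℕ< q) ≡ lookup xs (fromℕ< p)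
lookup-extend (x ∷ xs) ys {zero}  _ _ = refl
lookup-extend (x ∷ xs) ys {suc i} p q = lookup-extend xs ys (s<s⁻¹ p) (s<s⁻¹ q)

lookup-TM : ∀ {i n} → i ≤′ n → (q : i < length (TM n)) →
            lookup (TM n) (fromℕ< q) ≡ 𝒯ℳ i
lookup-TM ≤′-refl q = refl
lookup-TM {i} (≤′-step {n} i≤n) q =
  trans (lookup-extend (TM n) (complement (TM n)) p q) (lookup-TM i≤n p)
  where
  p : i < length (TM n)
  p = ≤-<-trans (≤′⇒≤ i≤n) (k<length-TM n)

take-applyUpTo : ∀ (x : InfWord) k (xs : Word) → k ≤ length xs →
  (∀ i (p : i < length xs) → i < k → lookup xs (fromℕ< p) ≡ x i) →
  take k xs ≡ applyUpTo x k
take-applyUpTo x zero    xs       _        _ = refl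
take-applyUpTo x (suc k) (y ∷ ys) (s≤s le) h =
  cong₂ _∷_ (h 0 z<s z<s)
    (take-applyUpTo (x ∘ suc) k ys le (λ i p i<k → h (suc i) (s<s p) (s<s i<k)))

TM-limit : Limit TM 𝒯ℳ
TM-limit k = k , λ n n≥k → take-applyUpTo 𝒯ℳ k (TM n)
  (≤-trans n≥k (≤-trans (n≤1+n _) (k<length-TM n)))
  (λ i p i<k → lookup-TM (≤⇒≤′ (≤-trans (n≤1+n _) (≤-trans i<k n≥k))) p)

{-# OPTIONS --safe #-}
module Submission where

-- Binary Nyldon words are the Hall words of the lexicographic order: merging
-- descents from right to left factorizes every word into a nondecreasing
-- sequence of Hall words, and this recovers any such sequence from its
-- concatenation.  For n ≥ 5, w n is the image of a word over four ordered
-- blocks, obtained from B₃B₂B₁ by iterating a morphism φ which, conjugated by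
-- b, is the square of the Thue–Morse morphism.  Both φ and the coding η of the
-- blocks preserve the lexicographic order and Hall words, which gives
-- monotonicity and the Nyldon property.  The limit follows from
-- w 1 ⋯ w n · b = T · T̄ · T̄ with T = TM (2n − 6), for n ≥ 4, since
-- TM (2n − 4) = T · T̄ · T̄ · T.

open import Defs
import Data.Bool.Base as Bool
open import Data.Bool.Base using (not; f<t)
import Data.Bool.Properties as Bool
open import Data.Empty using (⊥-elim)
open import Data.List.Base using (List; []; _∷_; [_]; _++_; _∷ʳ_; concat; concatMap; drop; foldr; length; take; applyUpTo)
open import Data.List.Properties using (++-assoc; ++-identityʳ; ++-conicalˡ; foldr-++; length-++; map-++; concat-++; concatMap-++; applyUpTo-∷ʳ; ∷ʳ-injectiveˡ)
import Data.List.Relation.Binary.Lex.Strict as Lex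
open import Data.List.Relation.Binary.Lex.Strict using (Lex-<; halt; this; next)
open import Data.List.Relation.Binary.Pointwise using (Pointwise-≡⇒≡; ≡⇒Pointwise-≡)
open import Data.List.Relation.Unary.All as All using (All; []; _∷_)
open import Data.List.Relation.Unary.Linked as Linked using (Linked; []; [-]; _∷_)
open import Data.Nat.Base using (ℕ; zero; suc; _+_; _*_; _∸_; _≤_; z≤n; s≤s; s≤s⁻¹)
open import Data.Nat.Properties using (≤-refl; ≤-trans; n≤1+n; m≤n+m; m≤m+n; m≤m*n; +-comm; *-comm; module ≤-Reasoning)
open import Data.Product.Base using (_×_; _,_; ∃-syntax; proj₁; proj₂)
open import Data.Sum.Base using (_⊎_; inj₁; inj₂)
open import Function.Base using (_∘_)
open import Relation.Binary.Definitions using (tri<; tri≈; tri>)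
open import Relation.Binary.PropositionalEquality using (_≡_; _≢_; refl; sym; trans; cong; cong₂; subst; subst₂; isEquivalence; resp₂; module ≡-Reasoning)
open import Relation.Nullary.Decidable using (Dec; yes; no; True; toWitness)
open import Relation.Nullary.Negation.Core using (¬_; contradiction)

-- Hall words

-- In Hall _⊏_ x s, s is the right factor of the standard factorization of x.
-- A letter has none; [] then makes the condition s ⪯ y of node hold for all y.
data Hall {A : Set} (_⊏_ : A → A → Set) : List A → List A → Set where
  letter : ∀ c → Hall _⊏_ [ c ] []
  node   : ∀ {x s y t} → Hall _⊏_ x s → Hall _⊏_ y t →
           Lex-< _≡_ _⊏_ y x → Lex-< _≡_ _⊏_ s y ⊎ s ≡ y →
           Hall _⊏_ (x ++ y) y

++-monoʳ-≺ : ∀ {A : Set} {_⊏_ : A → A → Set} z {x y} →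
             Lex-< _≡_ _⊏_ x y → Lex-< _≡_ _⊏_ (z ++ x) (z ++ y)
++-monoʳ-≺ []      lt = lt
++-monoʳ-≺ (_ ∷ z) lt = next refl (++-monoʳ-≺ z lt)

module _ {A B : Set} {_⊏ᴬ_ : A → A → Set} {_⊏ᴮ_ : B → B → Set} (f : A → List B) where

  private
    _≺ᴬ_ : List A → List A → Set
    _≺ᴬ_ = Lex-< _≡_ _⊏ᴬ_

    _≺ᴮ_ : List B → List B → Set
    _≺ᴮ_ = Lex-< _≡_ _⊏ᴮ_

  -- Images of letters are compared together with arbitrary continuations because one image may be a
  -- prefix of another, as happens for `η`.
  concatMap-mono-≺ : (∀ c x → [] ≺ᴮ (f c ++ x)) →
    (∀ {c d} → c ⊏ᴬ d → ∀ x y → (f c ++ concatMap f x) ≺ᴮ (f d ++ concatMap f y)) →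
    ∀ {x y} → x ≺ᴬ y → concatMap f x ≺ᴮ concatMap f y
  concatMap-mono-≺ pos mono halt                         = pos _ _
  concatMap-mono-≺ pos mono (this {xs = x} {ys = y} c⊏d) = mono c⊏d x y
  concatMap-mono-≺ pos mono (next {x = c} refl lt)      =
    ++-monoʳ-≺ (f c) (concatMap-mono-≺ pos mono lt)

  -- The standard right factor of the image of a node is the image of the
  -- right factor, so only the images of letters need a bound on theirs.
  Hall-concatMap : (∀ {x y} → x ≺ᴬ y → concatMap f x ≺ᴮ concatMap f y) →
    (∀ c → ∃[ s ] Hall _⊏ᴮ_ (f c) s × (∀ d y → s ≺ᴮ (f d ++ concatMap f y))) →
    ∀ {x s} → Hall _⊏ᴬ_ x s → ∃[ t ] Hall _⊏ᴮ_ (concatMap f x) t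
  Hall-concatMap mono images h = proj₁ (go h) , proj₁ (proj₂ (go h))
    where
    nonempty : ∀ {x s} → Hall _⊏ᴬ_ x s → ∃[ c ] ∃[ z ] x ≡ c ∷ z
    nonempty (letter c) = c , [] , refl
    nonempty (node {y = y} p _ _ _) with c , z , refl ← nonempty p = c , z ++ y , refl

    ⪯-mono : ∀ {x y} → x ≺ᴬ y ⊎ x ≡ y → concatMap f x ≺ᴮ concatMap f y ⊎ concatMap f x ≡ concatMap f y
    ⪯-mono (inj₁ lt)   = inj₁ (mono lt)
    ⪯-mono (inj₂ refl) = inj₂ refl

    -- The induction also carries a comparison of `t` with images of nonempty words. At a node `t`
    -- is itself an image and monotonicity applies; at a letter `images` supplies the bound.
    go : ∀ {x s} → Hall _⊏ᴬ_ x s → ∃[ t ] Hall _⊏ᴮ_ (concatMap f x) t ×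
         (∀ {d z} → s ≺ᴬ (d ∷ z) ⊎ s ≡ d ∷ z →
           t ≺ᴮ concatMap f (d ∷ z) ⊎ t ≡ concatMap f (d ∷ z))
    go (letter c) with s , h , s≺ ← images c =
      s , subst (λ x → Hall _⊏ᴮ_ x s) (sym (++-identityʳ (f c))) h , λ {d} {z} _ → inj₁ (s≺ d z)
    go (node {x} {y = y} p q y≺x s⪯y)
      with go p | go q | nonempty q
    ... | _ , p′ , bound | _ , q′ , _ | _ , _ , refl =
      concatMap f y ,
      subst (λ z → Hall _⊏ᴮ_ z (concatMap f y)) (sym (concatMap-++ f x y))
        (node p′ q′ (mono y≺x) (bound s⪯y)) ,
      ⪯-mono

-- Binary Hall words are the Nyldon words

≺-trans : ∀ {x y z} → x ≺ y → y ≺ z → x ≺ z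
≺-trans = Lex.<-transitive isEquivalence (resp₂ Bool._<_) Bool.<-trans

≺-irrefl : ∀ {x} → ¬ x ≺ x
≺-irrefl = Lex.<-irreflexive Bool.<-irrefl (≡⇒Pointwise-≡ refl)

≺⇒⋡ : ∀ {x y} → y ≺ x → ¬ x ⪯ y
≺⇒⋡ y≺x (inj₁ x≺y)  = ≺-irrefl (≺-trans x≺y y≺x)
≺⇒⋡ y≺x (inj₂ refl) = ≺-irrefl y≺x

infix 4 _≺?_ _⪯?_

_≺?_ : ∀ x y → Dec (x ≺ y)
_≺?_ = Lex.<-decidable Bool._≟_ Bool._<?_

_⪯?_ : ∀ x y → Dec (x ⪯ y)
x ⪯? y with Lex.<-compare sym Bool.<-cmp x y
... | tri< lt _ _ = yes (inj₁ lt)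
... | tri≈ _ eq _ = yes (inj₂ (Pointwise-≡⇒≡ eq))
... | tri> _ _ gt = no (≺⇒⋡ gt)

≺⊎⪰ : ∀ y x → y ≺ x ⊎ x ⪯ y
≺⊎⪰ y x with Lex.<-compare sym Bool.<-cmp y x
... | tri< lt _ _ = inj₁ lt
... | tri≈ _ eq _ = inj₂ (inj₂ (sym (Pointwise-≡⇒≡ eq)))
... | tri> _ _ gt = inj₂ (inj₁ gt)

x≺x++y : ∀ {x y} → y ≢ [] → x ≺ x ++ y
x≺x++y {[]}    {[]}    y≢[] = ⊥-elim (y≢[] refl)
x≺x++y {[]}    {_ ∷ _} _    = halt
x≺x++y {_ ∷ _}         y≢[] = next refl (x≺x++y y≢[])

Hallᵇ : Word → Word → Set
Hallᵇ = Hall Bool._<_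

IsHall : Word → Set
IsHall x = ∃[ s ] Hallᵇ x s

Hall⇒≢[] : ∀ {x s} → Hallᵇ x s → x ≢ []
Hall⇒≢[] (letter _)     ()
Hall⇒≢[] (node {x} {y = y} p _ _ _) eq = Hall⇒≢[] p (++-conicalˡ x y eq)

-- At a node, `y ≺ x` and `x` is a proper prefix of `x ++ y`. Through `≺-Linked`, a list that may
-- follow a Hall word may also follow its right factor.
suffix≺ : ∀ {x s} → Hallᵇ x s → s ≺ x
suffix≺ (letter _)        = halt
suffix≺ (node p q y≺x _) = ≺-trans y≺x (x≺x++y (Hall⇒≢[] q))

-- Factorization by merging descents

insert : Word → List Word → List Word
insert x []      = [ x ]
insert x (y ∷ L) with ≺⊎⪰ y x
... | inj₁ _ = insert (x ++ y) L
... | inj₂ _ = x ∷ y ∷ L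

concat-insert : ∀ x L → concat (insert x L) ≡ x ++ concat L
concat-insert x []      = refl
concat-insert x (y ∷ L) with ≺⊎⪰ y x
... | inj₁ _ = trans (concat-insert (x ++ y) L) (++-assoc x y (concat L))
... | inj₂ _ = refl

-- The link `s ⪯ y` is the last condition of `node`. After a merge the right factor is `y`, and the
-- remaining links start at `y`, so the invariant persists.
insert-Hall : ∀ {x s L} → Hallᵇ x s → Linked _⪯_ (s ∷ L) → All IsHall L →
              Linked _⪯_ (insert x L) × All IsHall (insert x L)
insert-Hall {L = []} h _ _ = [-] , (_ , h) ∷ []
insert-Hall {x} {L = y ∷ L} h (s⪯y ∷ lk) ((t , k) ∷ hs) with ≺⊎⪰ y x
... | inj₁ y≺x = insert-Hall (node h k y≺x s⪯y) lk hs
... | inj₂ x⪯y = x⪯y ∷ lk , (_ , h) ∷ (t , k) ∷ hs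

insert-⪯ : ∀ {x L} → Linked _⪯_ (x ∷ L) → insert x L ≡ x ∷ L
insert-⪯ {L = []} _ = refl
insert-⪯ {x} {y ∷ L} (x⪯y ∷ _) with ≺⊎⪰ y x
... | inj₁ y≺x = contradiction x⪯y (≺⇒⋡ y≺x)
... | inj₂ _   = refl

insert-≺ : ∀ {x y} L → y ≺ x → insert x (y ∷ L) ≡ insert (x ++ y) L
insert-≺ {x} {y} L y≺x with ≺⊎⪰ y x
... | inj₁ _   = refl
... | inj₂ x⪯y = contradiction x⪯y (≺⇒⋡ y≺x)

-- The start list is a parameter so that a prefix can be read in front of an already factorized
-- suffix.
insertLetters : List Word → Word → List Word
insertLetters = foldr (λ c → insert [ c ])

factorize : Word → List Word
factorize = insertLetters []

[]∷-Linked : ∀ {L} → Linked _⪯_ L → Linked _⪯_ ([] ∷ L)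
[]∷-Linked {[]}           _  = [-]
[]∷-Linked {[] ∷ _}       lk = inj₂ refl ∷ lk
[]∷-Linked {(_ ∷ _) ∷ _}  lk = inj₁ halt ∷ lk

≺-Linked : ∀ {x y L} → x ≺ y → Linked _⪯_ (y ∷ L) → Linked _⪯_ (x ∷ L)
≺-Linked _   [-]                = [-]
≺-Linked x≺y (inj₁ y≺z ∷ lk)  = inj₁ (≺-trans x≺y y≺z) ∷ lk
≺-Linked x≺y (inj₂ refl ∷ lk) = inj₁ x≺y ∷ lk

factorize-Hall : ∀ x → Linked _⪯_ (factorize x) × All IsHall (factorize x)
factorize-Hall []      = [] , []
factorize-Hall (c ∷ x) with lk , hs ← factorize-Hall x =
  insert-Hall (letter c) ([]∷-Linked lk) hs

concat-factorize : ∀ x → concat (factorize x) ≡ x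
concat-factorize []      = refl
concat-factorize (c ∷ x) =
  trans (concat-insert [ c ] (factorize x)) (cong (c ∷_) (concat-factorize x))

-- Inserting the letters of a Hall word rebuilds its tree before the word
-- can interact with what follows.
insertLetters-Hall : ∀ {x s L} → Hallᵇ x s → Linked _⪯_ (s ∷ L) →
                     insertLetters L x ≡ insert x L
insertLetters-Hall (letter _) _ = refl
insertLetters-Hall {L = L} (node {x} {_} {y} p q y≺x s⪯y) lk = begin
  insertLetters L (x ++ y)                ≡⟨ foldr-++ _ L x y ⟩
  insertLetters (insertLetters L y) x     ≡⟨ cong (λ M → insertLetters M x) ih ⟩
  insertLetters (y ∷ L) x                 ≡⟨ insertLetters-Hall p (s⪯y ∷ lk) ⟩
  insert x (y ∷ L)                        ≡⟨ insert-≺ L y≺x ⟩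
  insert (x ++ y) L                       ∎
  where
  open ≡-Reasoning
  -- Here `lk` links `y` to the head of `L`, so `y` stays a separate factor until `x` is rebuilt in
  -- front of it.
  ih : insertLetters L y ≡ y ∷ L
  ih = trans (insertLetters-Hall q (≺-Linked (suffix≺ q) lk)) (insert-⪯ lk)

-- Uniqueness of nondecreasing Hall factorizations: from the right, each factor is rebuilt from its
-- letters, and its link to the next one prevents a merge.
factorize-concat : ∀ {L} → Linked _⪯_ L → All IsHall L → factorize (concat L) ≡ L
factorize-concat {[]}    _  _              = refl
factorize-concat {x ∷ L} lk ((_ , h) ∷ hs) = begin
  factorize (x ++ concat L)                     ≡⟨ foldr-++ _ [] x (concat L) ⟩
  insertLetters (factorize (concat L)) x        ≡⟨ cong (λ M → insertLetters M x)
                                                     (factorize-concat (Linked.tail lk) hs) ⟩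
  insertLetters L x                             ≡⟨ insertLetters-Hall h (≺-Linked (suffix≺ h) lk) ⟩
  insert x L                                    ≡⟨ insert-⪯ lk ⟩
  x ∷ L                                         ∎
  where open ≡-Reasoning

-- `γs` and `[ x ]` are both nondecreasing Hall factorizations of `x`, so uniqueness identifies
-- them.
Hall-unfactorable : ∀ {x} → IsHall x → ¬ NondecreasingFactorization IsHall x
Hall-unfactorable {x} h (γs , 2≤ , _ , hs , lk , eq) =
  2≰1 (subst (λ L → 2 ≤ length L) γs≡[x] 2≤)
  where
  2≰1 : ¬ 2 ≤ 1
  2≰1 (s≤s ())

  γs≡[x] : γs ≡ [ x ]
  γs≡[x] = begin
    γs                        ≡⟨ factorize-concat lk hs ⟨
    factorize (concat γs)     ≡⟨ cong factorize (trans eq (sym (++-identityʳ x))) ⟩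
    factorize (concat [ x ])  ≡⟨ factorize-concat [-] (h ∷ []) ⟩
    [ x ]                     ∎
    where open ≡-Reasoning

Hall⊎factorable : ∀ x → x ≢ [] → IsHall x ⊎ NondecreasingFactorization IsHall x
Hall⊎factorable x x≢[] = split (factorize x) (factorize-Hall x) (concat-factorize x)
  where
  split : ∀ L → Linked _⪯_ L × All IsHall L → concat L ≡ x →
          IsHall x ⊎ NondecreasingFactorization IsHall x
  split []            _               eq = ⊥-elim (x≢[] (sym eq))
  split (y ∷ [])      (_ , (h ∷ []))  eq =
    inj₁ (subst IsHall (trans (sym (++-identityʳ y)) eq) h)
  split L@(_ ∷ _ ∷ _) (lk , hs)       eq =
    inj₂ (L , s≤s (s≤s z≤n) , All.map (Hall⇒≢[] ∘ proj₂) hs , hs , lk , eq)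

-- Mutual induction on `n`: the factors are strictly shorter than the word, so the two notions agree
-- on them, and Hall words of length at least 2 are characterized by the same recursion.
Nyldon⇒Hall : ∀ n x → length x ≤ n → NyldonWithin n x → IsHall x
Hall⇒Nyldon : ∀ n x → length x ≤ n → IsHall x → NyldonWithin n x

Nyldon⇒Hall (suc n) []            _  (inj₁ ())
Nyldon⇒Hall (suc n) []            _  (inj₂ (() , _))
Nyldon⇒Hall (suc n) (c ∷ [])       _ _             = [] , letter c
Nyldon⇒Hall (suc n) x@(_ ∷ _ ∷ _) le (inj₂ (_ , ¬fac)) with Hall⊎factorable x (λ ())
... | inj₁ h   = h
... | inj₂ fac = contradiction
  (NondecreasingFactorization-map
    (λ γ lt → Hall⇒Nyldon n γ (s≤s⁻¹ (≤-trans lt le))) fac) ¬fac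

Hall⇒Nyldon n       []            _  (_ , h) = contradiction refl (Hall⇒≢[] h)
Hall⇒Nyldon (suc n) (_ ∷ [])      _  _       = inj₁ refl
Hall⇒Nyldon (suc n) x@(_ ∷ _ ∷ _) le h       = inj₂ (s≤s (s≤s z≤n) ,
  Hall-unfactorable h ∘ NondecreasingFactorization-map
    (λ γ lt → Nyldon⇒Hall n γ (s≤s⁻¹ (≤-trans lt le))))

-- The blocks

data Block : Set where
  B₁ B₂ B₃ B₄ : Block

data _⊏_ : Block → Block → Set where
  1⊏2 : B₁ ⊏ B₂
  1⊏3 : B₁ ⊏ B₃
  1⊏4 : B₁ ⊏ B₄
  2⊏3 : B₂ ⊏ B₃
  2⊏4 : B₂ ⊏ B₄
  3⊏4 : B₃ ⊏ B₄

-- φ is the square of the Thue–Morse morphism read on blocks.  Written in the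
-- code 0 = b, 1 = ba, 2 = baa, the blocks are
-- B₁ = 102012, B₂ = 10201202, B₃ = 1012, B₄ = 101202.
φ : Block → List Block
φ B₁ = B₄ ∷ B₂ ∷ B₃ ∷ B₁ ∷ []
φ B₂ = B₄ ∷ B₂ ∷ B₃ ∷ B₂ ∷ B₁ ∷ []
φ B₃ = B₄ ∷ B₃ ∷ B₁ ∷ []
φ B₄ = B₄ ∷ B₃ ∷ B₂ ∷ B₁ ∷ []

φ-head : ∀ c x → ∃[ y ] φ c ++ x ≡ B₄ ∷ y
φ-head B₁ _ = _ , refl
φ-head B₂ _ = _ , refl
φ-head B₃ _ = _ , refl
φ-head B₄ _ = _ , refl

φ-mono : ∀ {x y} → Lex-< _≡_ _⊏_ x y → Lex-< _≡_ _⊏_ (concatMap φ x) (concatMap φ y)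
φ-mono = concatMap-mono-≺ φ
  (λ c x → subst (Lex-< _≡_ _⊏_ []) (sym (proj₂ (φ-head c x))) halt) λ where
    1⊏2 _ _ → next refl (next refl (next refl (this 1⊏2)))
    1⊏3 _ _ → next refl (this 2⊏3)
    1⊏4 _ _ → next refl (this 2⊏3)
    2⊏3 _ _ → next refl (this 2⊏3)
    2⊏4 _ _ → next refl (this 2⊏3)
    3⊏4 _ _ → next refl (next refl (this 1⊏2))

-- The right factor of each `φ c` begins with `B₃`, whereas every image begins with `B₄`.
φ-Hall : ∀ {x s} → Hall _⊏_ x s → ∃[ t ] Hall _⊏_ (concatMap φ x) t
φ-Hall = Hall-concatMap φ φ-mono λ where
    B₁ → _ , node 42-Hall 31-Hall (this 3⊏4) (inj₁ (this 2⊏3)) , 3≺φ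
    B₂ → _ , node 42-Hall 321-Hall (this 3⊏4) (inj₁ (this 2⊏3)) , 3≺φ
    B₃ → _ , node (letter B₄) 31-Hall (this 3⊏4) (inj₁ halt) , 3≺φ
    B₄ → _ , node (letter B₄) 321-Hall (this 3⊏4) (inj₁ halt) , 3≺φ
  where
  31-Hall  = node (letter B₃) (letter B₁) (this 1⊏3) (inj₁ halt)
  42-Hall  = node (letter B₄) (letter B₂) (this 2⊏4) (inj₁ halt)
  321-Hall = node (letter B₃) (node (letter B₂) (letter B₁) (this 1⊏2) (inj₁ halt))
                  (this 2⊏3) (inj₁ halt)

  3≺φ : ∀ {z} d y → Lex-< _≡_ _⊏_ (B₃ ∷ z) (φ d ++ concatMap φ y)
  3≺φ d y = subst (Lex-< _≡_ _⊏_ _) (sym (proj₂ (φ-head d _))) (this 3⊏4)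

blocks : ℕ → List Block
blocks zero    = B₃ ∷ B₂ ∷ B₁ ∷ []
blocks (suc m) = concatMap φ (blocks m)

blocks-Hall : ∀ m → ∃[ s ] Hall _⊏_ (blocks m) s
blocks-Hall zero    = _ , node (letter B₃)
  (node (letter B₂) (letter B₁) (this 1⊏2) (inj₁ halt)) (this 2⊏3) (inj₁ halt)
blocks-Hall (suc m) = φ-Hall (proj₂ (blocks-Hall m))

-- The seed begins with `B₃` and its image with `B₄`; `φ-mono` propagates this.
blocks-mono : ∀ m → Lex-< _≡_ _⊏_ (blocks m) (blocks (suc m))
blocks-mono zero    = this 3⊏4
blocks-mono (suc m) = φ-mono (blocks-mono m)

-- Blocks as binary words

ba baa bab baab babba babbabaa babbaabbabaa : Word
ba           = b ∷ a ∷ []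
baa          = ba ++ [ a ]
bab          = ba ++ [ b ]
baab         = baa ++ [ b ]
babba        = bab ++ ba
babbabaa     = babba ++ baa
babbaabbabaa = bab ++ ((baab ++ ba) ++ baa)

-- The bracketing follows the Hall trees built in `η-Hall`.
η : Block → Word
η B₁ = babbaabbabaa
η B₂ = (bab ++ (baab ++ ba)) ++ (baab ++ baa)
η B₃ = babbabaa
η B₄ = babba ++ (baab ++ baa)

η-head : ∀ c x → ∃[ y ] η c ++ x ≡ babba ++ y
η-head B₁ _ = _ , refl
η-head B₂ _ = _ , refl
η-head B₃ _ = _ , refl
η-head B₄ _ = _ , refl

-- η B₂ and η B₄ are η B₁ and η B₃ followed by bbaa; a prefix is still
-- compared correctly since every block starts with ba.
η-mono : ∀ {x y} → Lex-< _≡_ _⊏_ x y → concatMap η x ≺ concatMap η y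
η-mono = concatMap-mono-≺ η
  (λ c x → subst ([] ≺_) (sym (proj₂ (η-head c x))) halt) λ where
    1⊏2 x _ → ++-monoʳ-≺ babbaabbabaa (≺bb x)
    1⊏3 _ _ → ++-monoʳ-≺ babba (this f<t)
    1⊏4 _ _ → ++-monoʳ-≺ babba (this f<t)
    2⊏3 _ _ → ++-monoʳ-≺ babba (this f<t)
    2⊏4 _ _ → ++-monoʳ-≺ babba (this f<t)
    3⊏4 x _ → ++-monoʳ-≺ babbabaa (≺bb x)
  where
  ≺bb : ∀ x {z} → concatMap η x ≺ b ∷ b ∷ z
  ≺bb []      = halt
  ≺bb (c ∷ x) = subst (_≺ _) (sym (proj₂ (η-head c _))) (next refl (this f<t))

-- For closed words both order conditions are settled by evaluation.
node? : ∀ {x s y t} → Hallᵇ x s → Hallᵇ y t → {True (y ≺? x)} → {True (s ⪯? y)} → Hallᵇ (x ++ y) y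
node? p q {y≺x} {s⪯y} = node p q (toWitness y≺x) (toWitness s⪯y)

ba-Hall : Hallᵇ ba [ a ]
ba-Hall = node? (letter b) (letter a)

baa-Hall : Hallᵇ baa [ a ]
baa-Hall = node? ba-Hall (letter a)

baabbaa-Hall : Hallᵇ (baab ++ baa) baa
baabbaa-Hall = node? (node? baa-Hall (letter b)) baa-Hall

-- The right factor of each `η c` begins with `baa`, whereas every image begins with `bab`.
η-Hall : ∀ {x s} → Hall _⊏_ x s → ∃[ t ] Hallᵇ (concatMap η x) t
η-Hall = Hall-concatMap η η-mono λ where
    B₁ → _ , node? bab-Hall (node? baabba-Hall baa-Hall) , baa≺η
    B₂ → _ , node? (node? bab-Hall baabba-Hall) baabbaa-Hall , baa≺η
    B₃ → _ , node? babba-Hall baa-Hall , baa≺η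
    B₄ → _ , node? babba-Hall baabbaa-Hall , baa≺η
  where
  bab-Hall : Hallᵇ bab [ b ]
  bab-Hall = node? ba-Hall (letter b)

  babba-Hall : Hallᵇ babba ba
  babba-Hall = node? bab-Hall ba-Hall

  baabba-Hall : Hallᵇ (baab ++ ba) ba
  baabba-Hall = node? (node? baa-Hall (letter b)) ba-Hall

  baa≺η : ∀ {z} d y → baa ++ z ≺ η d ++ concatMap η y
  baa≺η d y = subst (_ ≺_) (sym (proj₂ (η-head d _))) (next refl (next refl (this f<t)))

-- η conjugated by b, which turns φ into the morphism θ.
η° : Block → Word
η° c = drop 1 (η c ∷ʳ b)

η-conjugate : ∀ x → concatMap η x ∷ʳ b ≡ b ∷ concatMap η° x
η-conjugate []      = refl
η-conjugate (c ∷ x) = begin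
  (η c ++ concatMap η x) ∷ʳ b     ≡⟨ ++-assoc (η c) _ _ ⟩
  η c ++ (concatMap η x ∷ʳ b)     ≡⟨ cong (η c ++_) (η-conjugate x) ⟩
  η c ++ b ∷ concatMap η° x       ≡⟨ ++-assoc (η c) [ b ] _ ⟨
  (η c ∷ʳ b) ++ concatMap η° x    ≡⟨ cong (_++ concatMap η° x) (letterwise c) ⟩
  b ∷ η° c ++ concatMap η° x      ∎
  where
  open ≡-Reasoning
  letterwise : ∀ c → η c ∷ʳ b ≡ b ∷ η° c
  letterwise B₁ = refl
  letterwise B₂ = refl
  letterwise B₃ = refl
  letterwise B₄ = refl

-- The square of the Thue-Morse morphism sending `a` to `ab` and `b` to `ba`.
θ : Letter → Word
θ a = TM 2
θ b = complement (TM 2)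

θ-complement : ∀ x → concatMap θ (complement x) ≡ complement (concatMap θ x)
θ-complement []      = refl
θ-complement (c ∷ x) = trans (cong₂ _++_ (letterwise c) (θ-complement x))
                             (sym (map-++ not (θ c) (concatMap θ x)))
  where
  letterwise : ∀ c → θ (not c) ≡ complement (θ c)
  letterwise a = refl
  letterwise b = refl

θ-TM : ∀ k → concatMap θ (TM k) ≡ TM (2 + k)
θ-TM zero    = refl
θ-TM (suc k) = trans (concatMap-++ θ (TM k) _)
  (cong₂ _++_ (θ-TM k) (trans (θ-complement (TM k)) (cong complement (θ-TM k))))

-- Both sides are morphisms in `x`, so evaluation on the four blocks suffices. For `η` itself this
-- fails at the third letter: `θ b` begins with `baa`, `η B₄` with `bab`.
η°-φ : ∀ x → concatMap η° (concatMap φ x) ≡ concatMap θ (concatMap η° x)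
η°-φ []      = refl
η°-φ (c ∷ x) = begin
  concatMap η° (φ c ++ concatMap φ x)                   ≡⟨ concatMap-++ η° (φ c) _ ⟩
  concatMap η° (φ c) ++ concatMap η° (concatMap φ x)    ≡⟨ cong₂ _++_ (letterwise c) (η°-φ x) ⟩
  concatMap θ (η° c) ++ concatMap θ (concatMap η° x)    ≡⟨ concatMap-++ θ (η° c) _ ⟨
  concatMap θ (η° c ++ concatMap η° x)                  ∎
  where
  open ≡-Reasoning
  letterwise : ∀ c → concatMap η° (φ c) ≡ concatMap θ (η° c)
  letterwise B₁ = refl
  letterwise B₂ = refl
  letterwise B₃ = refl
  letterwise B₄ = refl

-- The words w n

TM̄ : ℕ → Word
TM̄ k = complement (TM k)

-- Each application of `θ` raises every index by 2. Writing `m * 2` makes this increment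
-- definitional.
η°-blocks : ∀ m → concatMap η° (blocks m) ≡ TM (2 + m * 2) ++ TM̄ (4 + m * 2) ++ TM̄ (4 + m * 2)
η°-blocks zero    = refl
η°-blocks (suc m) = begin
  concatMap η° (concatMap φ (blocks m))              ≡⟨ η°-φ (blocks m) ⟩
  concatMap θ (concatMap η° (blocks m))              ≡⟨ cong (concatMap θ) (η°-blocks m) ⟩
  concatMap θ (TM j ++ TM̄ k ++ TM̄ k)                ≡⟨ concatMap-++ θ (TM j) _ ⟩
  concatMap θ (TM j) ++ concatMap θ (TM̄ k ++ TM̄ k)  ≡⟨ cong₂ _++_ (θ-TM j) (concatMap-++ θ (TM̄ k) _) ⟩
  TM (2 + j) ++ concatMap θ (TM̄ k) ++ concatMap θ (TM̄ k)
                                                     ≡⟨ cong (λ z → TM (2 + j) ++ z ++ z) θ-TM̄ ⟩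
  TM (2 + j) ++ TM̄ (2 + k) ++ TM̄ (2 + k)            ∎
  where
  open ≡-Reasoning
  j = 2 + m * 2
  k = 4 + m * 2
  θ-TM̄ : concatMap θ (TM̄ k) ≡ TM̄ (2 + k)
  θ-TM̄ = trans (θ-complement (TM k)) (cong complement (θ-TM k))

EndsIn : Letter → Word → Set
EndsIn c x = ∃[ y ] x ≡ y ∷ʳ c

complement-EndsIn : ∀ {c x} → EndsIn c x → EndsIn (not c) (complement x)
complement-EndsIn (y , refl) = _ , map-++ not y _

TM-suc-EndsIn : ∀ {c} k → EndsIn c (TM k) → EndsIn (not c) (TM (suc k))
TM-suc-EndsIn k e with z , eq ← complement-EndsIn e =
  TM k ++ z , trans (cong (TM k ++_) eq) (sym (++-assoc (TM k) z _))

-- Each doubling flips the last letter. Hence the letter that `dropLast` removes in `w` is `b`.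
TM-even-EndsIn : ∀ m → EndsIn a (TM (m * 2))
TM-even-EndsIn zero    = [] , refl
TM-even-EndsIn (suc m) = TM-suc-EndsIn (suc (m * 2)) (TM-suc-EndsIn (m * 2) (TM-even-EndsIn m))

dropLast-∷ʳ : ∀ {c x} → EndsIn c x → dropLast x ∷ʳ c ≡ x
dropLast-∷ʳ {c} (y , refl) = cong (_∷ʳ c) (go y)
  where
  go : ∀ y → dropLast (y ∷ʳ c) ≡ y
  go []          = refl
  go (_ ∷ [])    = refl
  go (d ∷ e ∷ y) = cong (d ∷_) (go (e ∷ y))

w-∷ʳ : ∀ m → w (5 + m) ∷ʳ b ≡ b ∷ TM (2 + m * 2) ++ TM̄ (4 + m * 2) ++ TM̄ (4 + m * 2)
w-∷ʳ m = begin
  -- After commuting, the product is `10 + m * 2`, from which both truncated subtractions compute.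
  w (5 + m) ∷ʳ b                                ≡⟨ cong (λ i → formula (i ∸ 8) (i ∸ 6) ∷ʳ b) (*-comm 2 (5 + m)) ⟩
  formula j k ∷ʳ b                              ≡⟨ cong (b ∷_) (++-assoc (TM j) _ _) ⟩
  b ∷ TM j ++ (TM̄ k ++ dropLast (TM̄ k)) ∷ʳ b   ≡⟨ cong (λ z → b ∷ TM j ++ z) (++-assoc (TM̄ k) _ _) ⟩
  b ∷ TM j ++ TM̄ k ++ dropLast (TM̄ k) ∷ʳ b     ≡⟨ cong (λ z → b ∷ TM j ++ TM̄ k ++ z)
                                                     (dropLast-∷ʳ (complement-EndsIn (TM-even-EndsIn (2 + m)))) ⟩
  b ∷ TM j ++ TM̄ k ++ TM̄ k                     ∎
  where
  open ≡-Reasoning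
  j = 2 + m * 2
  k = 4 + m * 2
  formula : ℕ → ℕ → Word
  formula j k = [ b ] ++ TM j ++ TM̄ k ++ dropLast (TM̄ k)

-- Appending `b` restores the dropped letter on the left and conjugates `η` to `η°` on the right; it
-- is then cancelled.
w-blocks : ∀ m → w (5 + m) ≡ concatMap η (blocks m)
w-blocks m = ∷ʳ-injectiveˡ _ _ (begin
  w (5 + m) ∷ʳ b                   ≡⟨ w-∷ʳ m ⟩
  b ∷ TM j ++ TM̄ k ++ TM̄ k        ≡⟨ cong (b ∷_) (η°-blocks m) ⟨
  b ∷ concatMap η° (blocks m)      ≡⟨ η-conjugate (blocks m) ⟨
  concatMap η (blocks m) ∷ʳ b      ∎)
  where
  open ≡-Reasoning
  j = 2 + m * 2
  k = 4 + m * 2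

w-Hall : ∀ n → 1 ≤ n → IsHall (w n)
w-Hall 1 _ = _ , letter a
w-Hall 2 _ = _ , letter b
w-Hall 3 _ = _ , ba-Hall
w-Hall 4 _ = _ , baabbaa-Hall
w-Hall (suc (suc (suc (suc (suc m))))) _ =
  subst IsHall (sym (w-blocks m)) (η-Hall (proj₂ (blocks-Hall m)))

w-mono : ∀ n → 1 ≤ n → w n ⪯ w (suc n)
w-mono 1 _ = inj₁ (this f<t)
w-mono 2 _ = inj₁ (next refl halt)
w-mono 3 _ = inj₁ (next refl (next refl halt))
w-mono 4 _ = inj₁ (next refl (next refl (this f<t)))
w-mono (suc (suc (suc (suc (suc m))))) _ =
  inj₁ (subst₂ _≺_ (sym (w-blocks m)) (sym (w-blocks (suc m))) (η-mono (blocks-mono m)))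

-- The limit of the concatenations

complement-involutive : ∀ x → complement (complement x) ≡ x
complement-involutive []      = refl
complement-involutive (c ∷ x) = cong₂ _∷_ (Bool.not-involutive c) (complement-involutive x)

TM-quarters : ∀ k → TM (2 + k) ≡ (TM k ++ TM̄ k ++ TM̄ k) ++ TM k
TM-quarters k = begin
  (T ++ T̄) ++ complement (T ++ T̄)        ≡⟨ cong ((T ++ T̄) ++_) (map-++ not T T̄) ⟩
  (T ++ T̄) ++ T̄ ++ complement T̄          ≡⟨ cong (λ z → (T ++ T̄) ++ T̄ ++ z) (complement-involutive T) ⟩
  (T ++ T̄) ++ T̄ ++ T                      ≡⟨ ++-assoc (T ++ T̄) T̄ T ⟨
  ((T ++ T̄) ++ T̄) ++ T                    ≡⟨ cong (_++ T) (++-assoc T T̄ T̄) ⟩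
  (T ++ T̄ ++ T̄) ++ T                      ∎
  where
  open ≡-Reasoning
  T = TM k
  T̄ = TM̄ k

concatTo-suc : ∀ (f : ℕ → Word) n → concatTo f (suc n) ≡ concatTo f n ++ f (suc n)
concatTo-suc f n = begin
  concat (applyUpTo (f ∘ suc) (suc n))             ≡⟨ cong concat (applyUpTo-∷ʳ (f ∘ suc) n) ⟨
  concat (applyUpTo (f ∘ suc) n ∷ʳ f (suc n))      ≡⟨ concat-++ (applyUpTo (f ∘ suc) n) _ ⟨
  concatTo f n ++ f (suc n) ++ []                  ≡⟨ cong (concatTo f n ++_) (++-identityʳ _) ⟩
  concatTo f n ++ f (suc n)                        ∎
  where open ≡-Reasoning

-- The `b` that follows `w (5 + m)` is appended anew, while its initial `b` completes the previous
-- concatenation. The next `T` is then the fourth quarter of `TM k`.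
concatTo-w : ∀ m → concatTo w (4 + m) ∷ʳ b ≡ TM (2 + m * 2) ++ TM̄ (2 + m * 2) ++ TM̄ (2 + m * 2)
concatTo-w zero    = refl
concatTo-w (suc m) = begin
  concatTo w (5 + m) ∷ʳ b                  ≡⟨ cong (_∷ʳ b) (concatTo-suc w (4 + m)) ⟩
  (P ++ w (5 + m)) ∷ʳ b                    ≡⟨ ++-assoc P _ _ ⟩
  P ++ (w (5 + m) ∷ʳ b)                    ≡⟨ cong (P ++_) (w-∷ʳ m) ⟩
  P ++ b ∷ T ++ TM̄ k ++ TM̄ k              ≡⟨ ++-assoc P [ b ] _ ⟨
  (P ∷ʳ b) ++ T ++ TM̄ k ++ TM̄ k           ≡⟨ cong (_++ T ++ TM̄ k ++ TM̄ k) (concatTo-w m) ⟩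
  (T ++ T̄ ++ T̄) ++ T ++ TM̄ k ++ TM̄ k     ≡⟨ ++-assoc (T ++ T̄ ++ T̄) T _ ⟨
  ((T ++ T̄ ++ T̄) ++ T) ++ TM̄ k ++ TM̄ k   ≡⟨ cong (_++ TM̄ k ++ TM̄ k) (TM-quarters (2 + m * 2)) ⟨
  TM k ++ TM̄ k ++ TM̄ k                    ∎
  where
  open ≡-Reasoning
  k = 4 + m * 2
  P = concatTo w (4 + m)
  T = TM (2 + m * 2)
  T̄ = TM̄ (2 + m * 2)

take-++ˡ : ∀ k (x y : Word) → k ≤ length x → take k (x ++ y) ≡ take k x
take-++ˡ zero    _       _ _        = refl
take-++ˡ (suc k) (c ∷ x) y (s≤s le) = cong (c ∷_) (take-++ˡ k x y le)

concatTo-w-prefix : ∀ m → concatTo w (4 + m) ++ b ∷ TM (2 + m * 2) ≡ TM (4 + m * 2)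
concatTo-w-prefix m = begin
  P ++ b ∷ T               ≡⟨ ++-assoc P [ b ] T ⟨
  (P ∷ʳ b) ++ T            ≡⟨ cong (_++ T) (concatTo-w m) ⟩
  (T ++ T̄ ++ T̄) ++ T      ≡⟨ TM-quarters (2 + m * 2) ⟨
  TM (4 + m * 2)           ∎
  where
  open ≡-Reasoning
  P = concatTo w (4 + m)
  T = TM (2 + m * 2)
  T̄ = TM̄ (2 + m * 2)

-- Guarantees that the first `k` letters lie inside the concatenation once `m` is at least `k`.
m≤length-concatTo-w : ∀ m → m ≤ length (concatTo w (4 + m))
m≤length-concatTo-w m = s≤s⁻¹ (begin
  suc m                                        ≤⟨ s≤s (m≤m*n m 2) ⟩
  suc (m * 2)                                  ≤⟨ ≤-trans (n≤1+n _) (n≤1+n _) ⟩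
  3 + m * 2                                    ≤⟨ k<length-TM (2 + m * 2) ⟩
  length T                                     ≤⟨ m≤m+n _ _ ⟩
  length T + length (T̄ ++ T̄)                  ≡⟨ length-++ T ⟨
  length (T ++ T̄ ++ T̄)                        ≡⟨ cong length (concatTo-w m) ⟨
  length (concatTo w (4 + m) ∷ʳ b)             ≡⟨ length-++ (concatTo w (4 + m)) ⟩
  length (concatTo w (4 + m)) + 1              ≡⟨ +-comm _ 1 ⟩
  suc (length (concatTo w (4 + m)))            ∎)
  where
  open ≤-Reasoning
  T = TM (2 + m * 2)
  T̄ = TM̄ (2 + m * 2)

w-limit : Limit (concatTo w) 𝒯ℳ
-- The closed form starts at index 4; the surplus `k` bounds both the length and the Thue-Morse
-- index from below.
w-limit k = 4 + k , prefix
  where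
  open ≡-Reasoning
  prefix : ∀ n → 4 + k ≤ n → take k (concatTo w n) ≡ applyUpTo 𝒯ℳ k
  prefix (suc (suc (suc (suc m)))) (s≤s (s≤s (s≤s (s≤s k≤m)))) = begin
    take k (concatTo w (4 + m))                          ≡⟨ take-++ˡ k (concatTo w (4 + m)) _
                                                              (≤-trans k≤m (m≤length-concatTo-w m)) ⟨
    take k (concatTo w (4 + m) ++ b ∷ TM (2 + m * 2))    ≡⟨ cong (take k) (concatTo-w-prefix m) ⟩
    take k (TM (4 + m * 2))                              ≡⟨ proj₂ (TM-limit k) (4 + m * 2)
                                                              (≤-trans k≤m (≤-trans (m≤m*n m 2) (m≤n+m _ 4))) ⟩
    applyUpTo 𝒯ℳ k                                       ∎

w-Nyldon : ∀ n → 1 ≤ n → Nyldon (w n)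
w-Nyldon n 1≤n = Hall⇒Nyldon (length (w n)) (w n) ≤-refl (w-Hall n 1≤n)

theorem6 : Limit (concatTo w) 𝒯ℳ
    × (∀ n → 1 ≤ n → w n ⪯ w (suc n))
    × (∀ n → 1 ≤ n → Nyldon (w n))
    × (∃[ f ] Limit (concatTo f) 𝒯ℳ
    × (∀ n → 1 ≤ n → f n ⪯ f (suc n))
    × (∀ n → 1 ≤ n → Nyldon (f n)))
theorem6 = w-limit , w-mono , w-Nyldon , w , w-limit , w-mono , w-Nyldon
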